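{- For every integer $k>1$, there is a graph $G$ with treewidth $k$ and local queue number at least $\lceil k/2\rceil+1$.
   Context: Graphs are finite, simple and undirected. Given a linear ordering $\prec$ of the vertex set of a graph, two edges $uv$ and $xy$ nest if $u \prec x \prec y \prec v$ or $x \prec u \prec v \prec y$ (for the endpoints named suitably). A queue is a set of edges no two of which nest. A queue layout of $G$ consists of a linear ordering $\prec$ of $V(G)$ and a partition of $E(G)$ into queues; it is $\ell$-local if every vertex has incident edges in at most $\ell$ queues (the total number of queues being arbitrary). The local queue number of $G$ is the smallest $\ell$ such that $G$ has an $\ell$-local queue layout. -}

module Defs where

open import Data.Fin.Base using (Fin)
open import Data.Fin.Subset using (Subset; _∈_; ∣_∣)
open import Data.List.Base using (List; _∷_; _∷ʳ_; length; tabulate)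
open import Data.List.Extrema.Nat using (max)
open import Data.List.Relation.Unary.Linked using (Linked)
open import Data.List.Relation.Unary.Unique.Propositional using (Unique)
open import Data.Nat.Base using (ℕ; _≤_; _<_; _∸_)
open import Data.Product.Base using (Σ-syntax; ∃-syntax; _×_)
open import Data.Sum.Base using (_⊎_)
open import Level using (Level; 0ℓ)
open import Relation.Binary.Construct.Closure.ReflexiveTransitive using (Star)
open import Relation.Binary.Core using (Rel)
open import Relation.Binary.Definitions using (Decidable; Symmetric; Irreflexive)
open import Relation.Binary.PropositionalEquality.Core using (_≡_)
open import Relation.Binary.Structures using (IsStrictTotalOrder)
open import Relation.Nullary.Negation.Core using (¬_)
open import Relation.Unary using (Pred)

IsLeast : {a : Level} → Pred ℕ a → Pred ℕ a
IsLeast P m = P m × (∀ n → P n → m ≤ n)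

record Graph : Set₁ where
  infix 4 _~_
  field
    order    : ℕ
    _~_      : Rel (Fin order) 0ℓ
    ~-dec    : Decidable _~_
    ~-sym    : Symmetric _~_
    ~-irrefl : Irreflexive _≡_ _~_

  Vertex : Set
  Vertex = Fin order

record IsTree (T : Graph) : Set where
  open Graph T
  field
    nonempty  : 0 < order
    connected : ∀ u v → Star _~_ u v
    acyclic   : ∀ (v : Vertex) (vs : List Vertex) → 2 ≤ length vs →
                Unique (v ∷ vs) → ¬ Linked _~_ (v ∷ (vs ∷ʳ v))

record TreeDecomposition (G : Graph) : Set₁ where
  open Graph G
  field
    tree   : Graph
    isTree : IsTree tree

  open Graph tree public using () renaming (order to numNodes; Vertex to Node; _~_ to _~ᵀ_)

  field
    bag            : Node → Subset order
    covers-vertex  : ∀ v → ∃[ t ] v ∈ bag t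
    covers-edge    : ∀ {u v} → u ~ v → ∃[ t ] (u ∈ bag t × v ∈ bag t)
    bags-connected : ∀ {v s t} → v ∈ bag s → v ∈ bag t →
                     Star (λ a b → a ~ᵀ b × v ∈ bag a × v ∈ bag b) s t

  -- The truncation only matters for the graph without vertices, whose
  -- decompositions get width 0 rather than -1.
  width : ℕ
  width = max 0 (tabulate (λ t → ∣ bag t ∣)) ∸ 1

IsTreewidth : Graph → ℕ → Set₁
IsTreewidth G = IsLeast (λ w → Σ[ D ∈ TreeDecomposition G ] TreeDecomposition.width D ≡ w)

Nest : {V : Set} → Rel V 0ℓ → (u v x y : V) → Set
Nest _≺_ u v x y = (u ≺ x × x ≺ y × y ≺ v) ⊎ (x ≺ u × u ≺ v × v ≺ y)

record QueueLayout (G : Graph) : Set₁ where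
  open Graph G
  infix 4 _≺_
  field
    _≺_                  : Rel Vertex 0ℓ
    ≺-isStrictTotalOrder : IsStrictTotalOrder _≡_ _≺_
    numQueues            : ℕ
    queue                : ∀ {u v} → u ~ v → Fin numQueues
    -- Edges are undirected; applied twice, this also makes queue independent
    -- of the proof of adjacency.
    queue-sym            : ∀ {u v} (e : u ~ v) (f : v ~ u) → queue e ≡ queue f
    -- Every edge is ranged over in both orientations, so all ways of naming
    -- the endpoints are covered.
    queue-nonnesting     : ∀ {u v x y} (e : u ~ v) (f : x ~ y) →
                           queue e ≡ queue f → ¬ Nest _≺_ u v x y

  Local : ℕ → Set
  Local ℓ = ∀ v → Σ[ Q ∈ Subset numQueues ]
              (∣ Q ∣ ≤ ℓ × (∀ {w} (e : v ~ w) → queue e ∈ Q))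

IsLocalQueueNumber : Graph → ℕ → Set₁
IsLocalQueueNumber G = IsLeast (λ ℓ → Σ[ L ∈ QueueLayout G ] QueueLayout.Local L ℓ)

{-# OPTIONS --safe #-}
module Submission where

-- The graph has a k-clique of roots, very many mids adjacent to all roots, and,
-- for each mid v and root b, many leaves adjacent to v and to the roots other
-- than b. Put ℓ = ⌈k/2⌉ and suppose that some layout is ℓ-local. By pigeonhole,
-- three mids v₀ ≺ v₁ ≺ v₂ lie on the same sides of the roots and agree in the
-- queues of their edges to the roots. Up to reversal, at least ℓ roots precede
-- them. Two edges from these roots to v₁ in one queue would nest with edges at
-- v₂, so they use up all ℓ queues at v₁, and any further edge from v₁ to the left
-- would nest with an edge at v₀ or v₂. As k > ℓ, some root b does not precede
-- them. The leaves of v₁ omitting b lie to the right of v₁, so two of them that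
-- agree in their queues have ℓ + 1 common neighbours on the left, which is
-- impossible for the same reason.
--
-- The exact value of the local queue number exists constructively because up to
-- renaming the queues there are only finitely many layouts.

open import Defs
open import Data.Bool.Base using (Bool; true; false; T)
open import Data.Bool.Properties using (T?)
open import Data.Empty using (⊥-elim)
open import Data.Fin.Base as Fin using (Fin; zero; suc; combine; inject≤; funToFin; finToFun)
open import Data.Fin.Properties as Fin
  using (_≟_; _<?_; any?; all?; ¬∀⟶∃¬; injective⇒≤; pigeonhole; combine-injective;
         inject≤-injective; finToFun-funToFin; +↔⊎; *↔×)
open import Data.Fin.Subset using (Subset; inside; outside; _∈_; _∉_; ∣_∣; ⊤; ⁅_⁆; _∪_)
  renaming (⊥ to ∅)
open import Data.Fin.Subset.Properties
  using (_∈?_; ∈⊤; ∉⊥; ∣⊤∣≡n; ∣⊥∣≡0; ∣⁅x⁆∣≡1; x∈⁅x⁆; x∈⁅y⁆⇒x≡y; x∈p∪q⁺; x∈p∪q⁻; anySubset?)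
open import Data.List.Base using (List; []; _∷_; _∷ʳ_; length; tabulate)
open import Data.List.Extrema.Nat using (xs≤max; max≤v⁺)
open import Data.List.Membership.DecPropositional using () renaming (_∈?_ to member?)
import Data.List.Membership.Propositional as List
open import Data.List.Relation.Unary.All using (All; []; _∷_)
import Data.List.Relation.Unary.All.Properties as All
open import Data.List.Relation.Unary.AllPairs using ([]; _∷_)
open import Data.List.Relation.Unary.Any using (here; there)
open import Data.List.Relation.Unary.Linked using (Linked; [-]; _∷_)
open import Data.List.Relation.Unary.Unique.Propositional using (Unique)
open import Data.Nat.Base as ℕ using (ℕ; zero; suc; _+_; _*_; _^_; _≤_; _<_; z≤n; s≤s; ⌈_/2⌉)
import Data.Nat.Properties as ℕ
open import Data.Product.Base using (Σ-syntax; ∃-syntax; ∃; _×_; _,_; proj₁; proj₂)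
open import Data.Product.Function.NonDependent.Propositional using (_×-↔_)
open import Data.Sum.Base as Sum using (_⊎_; inj₁; inj₂)
open import Data.Sum.Function.Propositional using (_⊎-↔_)
open import Data.Sum.Properties using (inj₁-injective; inj₂-injective)
open import Data.Vec.Base as Vec using (Vec; []; _∷_; here; there; lookup)
import Data.Vec.Functional as Vector
open import Data.Vec.Properties using (lookup∘tabulate)
open import Function.Base using (_∘_; flip)
open import Function.Bundles using (_↔_; Inverse)
open import Function.Construct.Composition using (_↔-∘_)
open import Function.Construct.Identity using (↔-id)
open import Function.Definitions using (Injective)
open import Level using (Level; 0ℓ)
open import Relation.Binary.Construct.Closure.ReflexiveTransitive as Star using (Star; ε; _◅_; _◅◅_)
import Relation.Binary.Construct.Flip.EqAndOrd as Flip
open import Relation.Binary.Core using (Rel)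
open import Relation.Binary.Definitions using (Tri; tri<; tri≈; tri>)
open import Relation.Binary.PropositionalEquality
  using (_≡_; _≢_; refl; sym; trans; cong; subst; isEquivalence)
open import Relation.Binary.Structures using (IsStrictTotalOrder)
open import Relation.Binary.Structures.Biased using (isStrictTotalOrderᶜ)
open import Relation.Nullary using (¬_; Dec; yes; no)
open import Relation.Nullary.Decidable
  using (⌊_⌋; ¬?; _×-dec_; _⊎-dec_; _→-dec_; map′; toWitness; fromWitness)
open import Relation.Unary using (Pred; Decidable)

private
  variable
    m n : ℕ

-- Finite subsets

-- The position of `x` among the elements of `Q`. It numbers the queues at a vertex by at most `ℓ`
-- values, so that `pigeonhole` applies.
rank : {Q : Subset n} {x : Fin n} → x ∈ Q → Fin ∣ Q ∣
rank {Q = inside  ∷ _} here      = zero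
rank {Q = inside  ∷ _} (there p) = suc (rank p)
rank {Q = outside ∷ _} (there p) = rank p

rank-injective : {Q : Subset n} {x y : Fin n} (p : x ∈ Q) (q : y ∈ Q) →
                 rank p ≡ rank q → x ≡ y
rank-injective {Q = inside  ∷ _} here      here      _  = refl
rank-injective {Q = inside  ∷ _} (there p) (there q) eq =
  cong suc (rank-injective p q (Fin.suc-injective eq))
rank-injective {Q = outside ∷ _} (there p) (there q) eq =
  cong suc (rank-injective p q eq)

injective⇒≤∣∣ : {Q : Subset n} (f : Fin m → Fin n) → Injective _≡_ _≡_ f →
                (∀ i → f i ∈ Q) → m ≤ ∣ Q ∣
injective⇒≤∣∣ f f-inj f∈Q =
  injective⇒≤ {f = rank ∘ f∈Q} (f-inj ∘ rank-injective (f∈Q _) (f∈Q _))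

∣p∪q∣≤∣p∣+∣q∣ : (p q : Subset n) → ∣ p ∪ q ∣ ≤ ∣ p ∣ + ∣ q ∣
∣p∪q∣≤∣p∣+∣q∣ []            []            = z≤n
∣p∪q∣≤∣p∣+∣q∣ (inside  ∷ p) (inside  ∷ q) =
  s≤s (ℕ.≤-trans (∣p∪q∣≤∣p∣+∣q∣ p q) (ℕ.+-monoʳ-≤ ∣ p ∣ (ℕ.n≤1+n ∣ q ∣)))
∣p∪q∣≤∣p∣+∣q∣ (inside  ∷ p) (outside ∷ q) = s≤s (∣p∪q∣≤∣p∣+∣q∣ p q)
∣p∪q∣≤∣p∣+∣q∣ (outside ∷ p) (inside  ∷ q) =
  ℕ.≤-trans (s≤s (∣p∪q∣≤∣p∣+∣q∣ p q)) (ℕ.≤-reflexive (sym (ℕ.+-suc ∣ p ∣ ∣ q ∣)))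
∣p∪q∣≤∣p∣+∣q∣ (outside ∷ p) (outside ∷ q) = ∣p∪q∣≤∣p∣+∣q∣ p q

image : (Fin m → Fin n) → Subset m → Subset n
image f []            = ∅
image f (inside  ∷ Q) = ⁅ f zero ⁆ ∪ image (f ∘ suc) Q
image f (outside ∷ Q) = image (f ∘ suc) Q

∣image∣≤ : (f : Fin m → Fin n) (Q : Subset m) → ∣ image f Q ∣ ≤ ∣ Q ∣
∣image∣≤ {n = n} f [] = ℕ.≤-reflexive (∣⊥∣≡0 n)
∣image∣≤ f (inside ∷ Q) = ℕ.≤-trans (∣p∪q∣≤∣p∣+∣q∣ ⁅ f zero ⁆ _)
  (ℕ.+-mono-≤ (ℕ.≤-reflexive (∣⁅x⁆∣≡1 (f zero))) (∣image∣≤ (f ∘ suc) Q))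
∣image∣≤ f (outside ∷ Q) = ∣image∣≤ (f ∘ suc) Q

∈-image⁺ : (f : Fin m → Fin n) {Q : Subset m} {x : Fin m} → x ∈ Q → f x ∈ image f Q
∈-image⁺ f {inside ∷ Q}  here      = x∈p∪q⁺ (inj₁ (x∈⁅x⁆ (f zero)))
∈-image⁺ f {inside ∷ Q}  (there p) = x∈p∪q⁺ (inj₂ (∈-image⁺ (f ∘ suc) p))
∈-image⁺ f {outside ∷ Q} (there p) = ∈-image⁺ (f ∘ suc) p

∈-image⁻ : (f : Fin m → Fin n) (Q : Subset m) {y : Fin n} → y ∈ image f Q → ∃[ x ] y ≡ f x
∈-image⁻ f []            y∈ = ⊥-elim (∉⊥ y∈)
∈-image⁻ f (inside ∷ Q)  y∈ with x∈p∪q⁻ ⁅ f zero ⁆ _ y∈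
... | inj₁ y∈₁ = zero , x∈⁅y⁆⇒x≡y (f zero) y∈₁
... | inj₂ y∈₂ with x , eq ← ∈-image⁻ (f ∘ suc) Q y∈₂ = suc x , eq
∈-image⁻ f (outside ∷ Q) y∈ with x , eq ← ∈-image⁻ (f ∘ suc) Q y∈ = suc x , eq

-- Cliques and treewidth

Avoiding : {V : Set} → Rel V 0ℓ → Pred V 0ℓ → Rel V 0ℓ
Avoiding R P a b = R a b × ¬ P a × ¬ P b

last-outside : {V : Set} {R : Rel V 0ℓ} {P : Pred V 0ℓ} → Decidable P → {a b : V} →
  Star R a b → ¬ P a → P b →
  ∃[ y ] ∃[ s ] Star (Avoiding R P) a y × R y s × ¬ P y × P s
last-outside P? ε ¬Pa Pb = ⊥-elim (¬Pa Pb)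
last-outside P? (_◅_ {j = c} aRc cRb) ¬Pa Pb with P? c
... | yes Pc = _ , _ , ε , aRc , ¬Pa , Pc
... | no ¬Pc with y , s , cRy , rest ← last-outside P? cRb ¬Pc Pb =
  y , s , (aRc , ¬Pa , ¬Pc) ◅ cRy , rest

-- The list leaves out the first vertex, which fits the form `v ∷ vs` of the cycles in
-- `IsTree.acyclic`.
data Path {V : Set} (R : Rel V 0ℓ) : V → V → List V → Set where
  stop : ∀ {a} → Path R a a []
  step : ∀ {a b c vs} → R a c → All (a ≢_) (c ∷ vs) → Path R c b vs → Path R a b (c ∷ vs)

module _ {V : Set} {R : Rel V 0ℓ} where

  Path-suffix : ∀ {a b x vs} → Path R a b vs → x List.∈ vs → ∃ (Path R x b)
  Path-suffix (step _ _ p) (here refl) = _ , p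
  Path-suffix (step _ _ p) (there x∈)  = Path-suffix p x∈

  Path-unique : ∀ {a b vs} → Path R a b vs → Unique (a ∷ vs)
  Path-unique stop          = [] ∷ []
  Path-unique (step _ a≢ p) = a≢ ∷ Path-unique p

  Path-linked : ∀ {a b c vs} → Path R a b vs → R b c → Linked R (a ∷ (vs ∷ʳ c))
  Path-linked stop         bRc = bRc ∷ [-]
  Path-linked (step r _ p) bRc = r ∷ Path-linked p bRc

Path-map : {V : Set} {R S : Rel V 0ℓ} → (∀ {a b} → R a b → S a b) →
           ∀ {a b vs} → Path R a b vs → Path S a b vs
Path-map f stop          = stop
Path-map f (step r a≢ p) = step (f r) a≢ (Path-map f p)

Path-all : {V : Set} {R : Rel V 0ℓ} {P : Pred V 0ℓ} → (∀ {a b} → R a b → P b) →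
           ∀ {a b vs} → Path R a b vs → All P vs
Path-all f stop         = []
Path-all f (step r _ p) = f r ∷ Path-all f p

-- Loop erasure: if the start recurs on the path found for the rest of the walk, only the suffix
-- from there is kept.
Star⇒Path : {R : Rel (Fin n) 0ℓ} {a b : Fin n} → Star R a b → ∃ (Path R a b)
Star⇒Path ε = _ , stop
Star⇒Path (_◅_ {i = a} {j = c} r rs) with vs , p ← Star⇒Path rs | member? _≟_ a (c ∷ vs)
... | yes (here refl) = _ , p
... | yes (there a∈)  = Path-suffix p a∈
... | no a∉           = _ , step r (All.¬Any⇒All¬ _ a∉) p

module _ (T : Graph) (isTree : IsTree T) where
  open Graph T
  open IsTree isTree

  -- Otherwise a path from `y` to `y′` that avoids `s` would close up to a cycle through `s`.
  neighbours-separated : ∀ {s y y′} → s ~ y → y′ ~ s →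
                         Star (Avoiding _~_ (s ≡_)) y y′ → y ≡ y′
  neighbours-separated {s} {y} {y′} s~y y′~s walk with y ≟ y′
  ... | yes y≡y′ = y≡y′
  ... | no  y≢y′ with vs , p ← Star⇒Path walk =
    ⊥-elim (acyclic s (y ∷ vs) (s≤s (nonempty′ p))
                 ((s≢y ∷ Path-all (proj₂ ∘ proj₂) p) ∷ Path-unique p)
                 (s~y ∷ Path-linked (Path-map proj₁ p) y′~s))
    where
    s≢y : s ≢ y
    s≢y refl = ~-irrefl refl s~y
    nonempty′ : ∀ {vs} → Path (Avoiding _~_ (s ≡_)) y y′ vs → 1 ≤ length vs
    nonempty′ stop         = ⊥-elim (y≢y′ refl)
    nonempty′ (step _ _ _) = s≤s z≤n

module _ {G : Graph} (D : TreeDecomposition G) where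
  open Graph G
  open TreeDecomposition D
  private module T = Graph tree

  walk-avoids : ∀ {u s a b} → s ≢ a → Star (λ c d → c ~ᵀ d × u ∈ bag c × u ∈ bag d) a b →
                u ∉ bag s → Star (Avoiding _~ᵀ_ (s ≡_)) a b
  walk-avoids s≢a walk u∉s = Star.map
    (λ where (c~d , u∈c , u∈d) → c~d , (λ where refl → u∉s u∈c) , (λ where refl → u∉s u∈d)) walk

  -- If all vertices of c share the bag t, then they also share the bag of the
  -- first node s met on a walk from t to the bags of u. Otherwise a walk from t
  -- through the bags of some c i, and then through those of u, leads to s
  -- within the bags of u, contradicting neighbours-separated.
  extend-bag : ∀ {m} (c : Fin m → Vertex) {u t} → (∀ i → c i ~ u) → (∀ i → c i ∈ bag t) →
               ∃[ s ] u ∈ bag s × (∀ i → c i ∈ bag s)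
  extend-bag c {u} {t} c~u c∈t with u ∈? bag t
  ... | yes u∈t = t , u∈t , c∈t
  ... | no  u∉t
    with r , u∈r ← covers-vertex u
    with y , s , t⇝y , y~s , u∉y , u∈s ←
      last-outside (λ a → u ∈? bag a) (IsTree.connected isTree t r) u∉t u∈r
    = s , u∈s , c∈s
    where
    c∈s : ∀ i → c i ∈ bag s
    c∈s i with c i ∈? bag s
    ... | yes ci∈s = ci∈s
    ... | no  ci∉s
      with sᵢ , ci∈sᵢ , u∈sᵢ ← covers-edge (c~u i)
      with z , _ , sᵢ⇝z , (z~s , u∈z , _) , s≢z , refl ←
        last-outside (s ≟_) (bags-connected u∈sᵢ u∈s) (λ where refl → ci∉s ci∈sᵢ) refl
      = ⊥-elim (u∉y (subst (λ a → u ∈ bag a) (sym y≡z) u∈z))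
      where
      y⇝t : Star (Avoiding _~ᵀ_ (s ≡_)) y t
      y⇝t = Star.reverse (λ where
        (a~b , u∉a , u∉b) →
          T.~-sym a~b , (λ where refl → u∉b u∈s) , (λ where refl → u∉a u∈s)) t⇝y
      y≡z : y ≡ z
      y≡z = neighbours-separated tree isTree (T.~-sym y~s) z~s
        (y⇝t ◅◅ walk-avoids (λ where refl → ci∉s (c∈t i)) (bags-connected (c∈t i) ci∈sᵢ) ci∉s ◅◅
         Star.map (λ where ((a~b , _) , s≢a , s≢b) → a~b , s≢a , s≢b) sᵢ⇝z)

  -- Induction on the clique: `extend-bag` moves from a bag shared by all vertices but the first to
  -- one that contains the first as well.
  clique-in-bag : ∀ {m} (c : Fin m → Vertex) → (∀ {i j} → i ≢ j → c i ~ c j) →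
                  ∃[ t ] ∀ i → c i ∈ bag t
  clique-in-bag {zero}  c _ = Fin.fromℕ< (IsTree.nonempty isTree) , λ ()
  clique-in-bag {suc m} c clique
    with t , c∈t ← clique-in-bag (c ∘ suc) (λ i≢j → clique (i≢j ∘ Fin.suc-injective))
    with s , c₀∈s , c∈s ← extend-bag (c ∘ suc) (λ i → clique (λ ())) c∈t
    = s , λ where
      zero    → c₀∈s
      (suc i) → c∈s i

  clique⇒≤width : ∀ {k} (c : Fin (suc k) → Vertex) → (∀ {i j} → i ≢ j → c i ~ c j) → k ≤ width
  clique⇒≤width {k} c clique with t , c∈t ← clique-in-bag c clique =
    ℕ.∸-monoˡ-≤ 1 (ℕ.≤-trans (injective⇒≤∣∣ c c-injective c∈t)
      (All.tabulate⁻ (xs≤max 0 (tabulate (λ t → ∣ bag t ∣))) t))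
    where
    c-injective : Injective _≡_ _≡_ c
    c-injective {i} {j} eq with i ≟ j
    ... | yes i≡j = i≡j
    ... | no  i≢j = ⊥-elim (~-irrefl eq (clique i≢j))

-- Tree decompositions of height two

-- `P` can be left only by the step from `a` to `v`, so a walk without `a` stays in `P`, whereas `v`
-- lies outside.
no-return : {V : Set} {R : Rel V 0ℓ} {P : Pred V 0ℓ} {a v : V} →
            (∀ {p q} → P p → R p q → ¬ (p ≡ a × q ≡ v) → P q) → ¬ P v →
            ∀ {x xs} → P x → All (a ≢_) (x ∷ xs) → ¬ Linked R (x ∷ (xs ∷ʳ v))
no-return closed ¬Pv {xs = []}     Px (a≢x ∷ []) (r ∷ [-]) = ¬Pv (closed Px r (a≢x ∘ sym ∘ proj₁))
no-return closed ¬Pv {xs = _ ∷ _} Px (a≢x ∷ a≢xs) (r ∷ rs) =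
  no-return closed ¬Pv (closed Px r (a≢x ∘ sym ∘ proj₁)) a≢xs rs

module _ (parent : Fin n → Fin n) (top : Fin n) (height-two : ∀ t → parent (parent t) ≡ top) where

  -- A rooted tree given by its parent map. The root `top` is its own parent, and `s ≢ t` removes
  -- this loop.
  parentTree : Graph
  parentTree = record
    { order    = n
    ; _~_      = λ s t → s ≢ t × (parent s ≡ t ⊎ parent t ≡ s)
    ; ~-dec    = λ s t → ¬? (s ≟ t) ×-dec (parent s ≟ t ⊎-dec parent t ≟ s)
    ; ~-sym    = λ (s≢t , st) → s≢t ∘ sym , Sum.swap st
    ; ~-irrefl = λ s≡t (s≢t , _) → s≢t s≡t
    }

  open Graph parentTree

  up : ∀ t {P : Pred (Fin n) 0ℓ} → P t → P (parent t) → Star (λ a b → a ~ b × P a × P b) t (parent t)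
  up t {P} Pt Pt′ with t ≟ parent t
  ... | yes eq = subst (Star _ t) eq ε
  ... | no neq = ((neq , inj₁ refl) , Pt , Pt′) ◅ ε

  down : ∀ t {P : Pred (Fin n) 0ℓ} → P t → P (parent t) → Star (λ a b → a ~ b × P a × P b) (parent t) t
  down t Pt Pt′ = Star.reverse (λ (a~b , Pa , Pb) → ~-sym a~b , Pb , Pa) (up t Pt Pt′)

  parent-top : parent top ≡ top
  parent-top = trans (cong parent (sym (height-two top))) (height-two (parent top))

  private
    root-path : ∀ t → Star _~_ t top
    root-path t = subst (Star _~_ t) (height-two t)
      -- `Fin n` serves as an always true predicate, with `t` as its proof.
      (Star.map proj₁ (up t {λ _ → Fin n} t t ◅◅ up (parent t) {λ _ → Fin n} t t))

    -- For `z` other than `top` this is the whole subtree at `z`, since every grandparent is `top`.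
    Below : Fin n → Pred (Fin n) 0ℓ
    Below z t = t ≡ z ⊎ parent t ≡ z

    module _ {z} (z≢parent : z ≢ parent z) where

      top≢ : top ≢ z
      top≢ refl = z≢parent (sym parent-top)

      parent∉Below : ¬ Below z (parent z)
      parent∉Below (inj₁ eq) = z≢parent (sym eq)
      parent∉Below (inj₂ eq) = top≢ (trans (sym (height-two z)) eq)

      leave : ∀ {p q} → Below z p → p ~ q → ¬ (p ≡ z × q ≡ parent z) → Below z q
      leave (inj₁ refl) (_ , inj₁ refl) neq = ⊥-elim (neq (refl , refl))
      leave (inj₁ refl) (_ , inj₂ eq)   neq = inj₂ eq
      leave (inj₂ refl) (_ , inj₁ refl) neq = inj₁ refl
      leave (inj₂ refl) (_ , inj₂ refl) neq = ⊥-elim (top≢ (sym (height-two _)))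

      enter : ∀ {p q} → ¬ Below z p → p ~ q → ¬ (p ≡ parent z × q ≡ z) → ¬ Below z q
      enter p∉ p~q neq q∈ = p∉ (leave q∈ (~-sym p~q) λ (q≡z , p≡) → neq (p≡ , q≡z))

    -- One end of the first edge va of a cycle is the parent of the other end z. It is
    -- the only edge between the nodes below z and the rest, so the walk from a back
    -- to v cannot avoid it.
    acyclic : ∀ v vs → 2 ≤ length vs → Unique (v ∷ vs) → ¬ Linked _~_ (v ∷ (vs ∷ʳ v))
    acyclic v (a ∷ b ∷ vs) _ ((v≢a ∷ v≢b ∷ _) ∷ (a≢ ∷ _)) ((_ , inj₁ refl) ∷ a~b ∷ rest) =
      no-return (enter v≢a) (λ ¬v → ¬v (inj₁ refl))
        (enter v≢a (parent∉Below v≢a) a~b (v≢b ∘ sym ∘ proj₂)) a≢ rest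
    acyclic v (a ∷ b ∷ vs) _ ((v≢a ∷ v≢b ∷ _) ∷ (a≢ ∷ _)) ((_ , inj₂ refl) ∷ a~b ∷ rest) =
      no-return (leave (v≢a ∘ sym)) (parent∉Below (v≢a ∘ sym))
        (leave (v≢a ∘ sym) (inj₁ refl) a~b (v≢b ∘ sym ∘ proj₂)) a≢ rest
    acyclic v (_ ∷ []) (s≤s ())

  parentTree-isTree : IsTree parentTree
  parentTree-isTree = record
    { nonempty  = ℕ.≤-<-trans z≤n (Fin.toℕ<n top)
    ; connected = λ u v → root-path u ◅◅ Star.reverse ~-sym (root-path v)
    ; acyclic   = acyclic
    }

module _ {k : ℕ} (base : Fin n → Fin k → Fin n) where

  private
    _◁_ : Rel (Fin n) 0ℓ
    u ◁ w = ∃[ i ] u ≡ base w i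

  -- A vertex may occur among its own bases, which adds no edge. This allows the roots, whose bases
  -- are all the roots, to form a clique.
  attach : Graph
  attach = record
    { order    = n
    ; _~_      = λ u w → u ≢ w × (u ◁ w ⊎ w ◁ u)
    ; ~-dec    = λ u w → ¬? (u ≟ w) ×-dec (any? (λ i → u ≟ base w i) ⊎-dec any? (λ i → w ≟ base u i))
    ; ~-sym    = λ (u≢w , uw) → u≢w ∘ sym , Sum.swap uw
    ; ~-irrefl = λ u≡w (u≢w , _) → u≢w u≡w
    }

  -- The vertices double as nodes of the decomposition. A bag has at most `k + 1` elements: the
  -- vertex `t` itself and its bases.
  InBag : Rel (Fin n) 0ℓ
  InBag u t = u ≡ t ⊎ u ◁ t

  module _ (parent : Fin n → Fin n) (top : Fin n) (height-two : ∀ t → parent (parent t) ≡ top)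
           (inherit : ∀ {u t} → u ◁ t → InBag u (parent t))
           (attach-top : ∀ {u} → InBag u top → parent u ≡ top) where

    private
      family : Fin n → Fin (suc k) → Fin n
      family t = t Vector.∷ base t

      bag : Fin n → Subset n
      bag t = image (family t) ⊤

      ∈-bag⁺ : ∀ {u t} → InBag u t → u ∈ bag t
      ∈-bag⁺ {t = t} (inj₁ refl)       = ∈-image⁺ (family t) {⊤} {zero} ∈⊤
      ∈-bag⁺ {t = t} (inj₂ (i , refl)) = ∈-image⁺ (family t) {⊤} {suc i} ∈⊤

      ∈-bag⁻ : ∀ {u t} → u ∈ bag t → InBag u t
      ∈-bag⁻ {t = t} u∈ with ∈-image⁻ (family t) ⊤ u∈
      ... | zero  , eq = inj₁ eq
      ... | suc i , eq = inj₂ (i , eq)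

      Within : Fin n → Rel (Fin n) 0ℓ
      Within u a b = Graph._~_ (parentTree parent top height-two) a b × u ∈ bag a × u ∈ bag b

      -- Climb from `t` through bags that contain `u`. Either `u` is `t` or its parent, or the climb
      -- ends at `top`, and then one step down leads to `u` by `attach-top`. Any two bags of `u` are
      -- thus connected via the node `u`.
      to-own-bag : ∀ {u t} → u ∈ bag t → Star (Within u) t u
      to-own-bag {u} {t} u∈t with ∈-bag⁻ u∈t
      ... | inj₁ refl = ε
      ... | inj₂ u◁t with inherit u◁t
      ...   | inj₁ refl = up parent top height-two t u∈t (∈-bag⁺ (inj₁ refl))
      ...   | inj₂ u◁p =
        up parent top height-two t u∈t u∈p ◅◅
        up parent top height-two (parent t) u∈p (∈-bag⁺ (inherit u◁p)) ◅◅
        subst (λ a → Star (Within u) a u) (trans (attach-top u∈top) (sym (height-two t)))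
          (down parent top height-two u (∈-bag⁺ (inj₁ refl))
            (∈-bag⁺ (subst (InBag u) (sym (attach-top u∈top)) u∈top)))
        where
        u∈p : u ∈ bag (parent t)
        u∈p = ∈-bag⁺ (inj₂ u◁p)
        u∈top : InBag u top
        u∈top = subst (InBag u) (height-two t) (inherit u◁p)

    decomposition : TreeDecomposition attach
    decomposition = record
      { tree           = parentTree parent top height-two
      ; isTree         = parentTree-isTree parent top height-two
      ; bag            = bag
      ; covers-vertex  = λ v → v , ∈-bag⁺ (inj₁ refl)
      ; covers-edge    = λ where
          (_ , inj₁ u◁w) → _ , ∈-bag⁺ (inj₂ u◁w) , ∈-bag⁺ (inj₁ refl)
          (_ , inj₂ w◁u) → _ , ∈-bag⁺ (inj₁ refl) , ∈-bag⁺ (inj₂ w◁u)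
      ; bags-connected = λ u∈s u∈t → to-own-bag u∈s ◅◅
          Star.reverse (λ (a~b , u∈a , u∈b) →
            Graph.~-sym (parentTree parent top height-two) a~b , u∈b , u∈a) (to-own-bag u∈t)
      }

    width≤ : TreeDecomposition.width decomposition ≤ k
    width≤ = ℕ.∸-monoˡ-≤ 1 (max≤v⁺ {xs = tabulate (λ t → ∣ bag t ∣)} z≤n
      (All.tabulate⁺ (λ t → ℕ.≤-trans (∣image∣≤ (family t) ⊤) (ℕ.≤-reflexive (∣⊤∣≡n (suc k))))))

-- Existence of the local queue number

least : {a : Level} {P : Pred ℕ a} → Decidable P → ∀ {m} → P m → ∃ (IsLeast P)
least P? {zero}  P0 = 0 , P0 , λ _ _ → z≤n
least P? {suc m} Pm with P? 0
... | yes P0 = 0 , P0 , λ _ _ → z≤n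
... | no ¬P0 with j , Pj , j-min ← least (P? ∘ suc) Pm = suc j , Pj , λ where
  zero    P0 → ⊥-elim (¬P0 P0)
  (suc i) Pi → s≤s (j-min i Pi)

Searchable : Set → Set₁
Searchable A = {P : Pred A 0ℓ} → Decidable P → Dec (∃ P)

searchBool : Searchable Bool
searchBool P? = map′ (λ where (inj₁ p) → true , p
                              (inj₂ p) → false , p)
                     (λ where (true , p)  → inj₁ p
                              (false , p) → inj₂ p)
                     (P? true ⊎-dec P? false)

searchVec : {A : Set} → Searchable A → Searchable (Vec A n)
searchVec {n = zero}  search P? = map′ ([] ,_) (λ where ([] , p) → p) (P? [])
searchVec {n = suc n} search P? =
  map′ (λ (a , as , p) → a ∷ as , p) (λ where (a ∷ as , p) → a , as , p)
       (search λ a → searchVec search λ as → P? (a ∷ as))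

-- Functions of two vertices as data, which `searchVec` can search exhaustively without function
-- extensionality.
Table : Set → ℕ → Set
Table A n = Vec (Vec A n) n

entry : {A : Set} → Table A n → Fin n → Fin n → A
entry t u v = lookup (lookup t u) v

table : {A : Set} → (Fin n → Fin n → A) → Table A n
table f = Vec.tabulate (Vec.tabulate ∘ f)

entry∘table : {A : Set} (f : Fin n → Fin n → A) → ∀ u v → entry (table f) u v ≡ f u v
entry∘table f u v = trans (cong (λ r → lookup r v) (lookup∘tabulate _ u)) (lookup∘tabulate (f u) v)

tri? : {A B C : Set} → Dec A → Dec B → Dec C → Dec (Tri A B C)
tri? (yes a) (no ¬b) (no ¬c) = yes (tri< a ¬b ¬c)
tri? (no ¬a) (yes b) (no ¬c) = yes (tri≈ ¬a b ¬c)
tri? (no ¬a) (no ¬b) (yes c) = yes (tri> ¬a ¬b c)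
tri? (yes a) (yes b) _       = no λ where
  (tri< _ ¬b _) → ¬b b
  (tri≈ ¬a _ _) → ¬a a
  (tri> ¬a _ _) → ¬a a
tri? (yes a) _       (yes c) = no λ where
  (tri< _ _ ¬c) → ¬c c
  (tri≈ ¬a _ _) → ¬a a
  (tri> ¬a _ _) → ¬a a
tri? _       (yes b) (yes c) = no λ where
  (tri< _ ¬b _) → ¬b b
  (tri≈ _ _ ¬c) → ¬c c
  (tri> _ ¬b _) → ¬b b
tri? (no ¬a) (no ¬b) (no ¬c) = no λ where
  (tri< a _ _) → ¬a a
  (tri≈ _ b _) → ¬b b
  (tri> _ _ c) → ¬c c

module _ (G : Graph) where
  open Graph G

  HasLocalLayout : ℕ → Set₁
  HasLocalLayout ℓ = Σ[ L ∈ QueueLayout G ] QueueLayout.Local L ℓ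

  private
    -- A candidate layout. Colours are given to all ordered pairs, not only to edges, so that they
    -- fit into a table.
    module Code {m : ℕ} (before : Vertex → Vertex → Bool)
                (colour : Vertex → Vertex → Fin m) (ℓ : ℕ) where

      _≺_ : Rel Vertex 0ℓ
      u ≺ v = T (before u v)

      Valid : Set
      Valid = (∀ x y z → x ≺ y → y ≺ z → x ≺ z)
            × (∀ x y → Tri (x ≺ y) (x ≡ y) (y ≺ x))
            × (∀ u v → u ~ v → colour u v ≡ colour v u)
            × (∀ u v x y → u ~ v → x ~ y → colour u v ≡ colour x y → ¬ Nest _≺_ u v x y)
            × (∀ v → Σ[ Q ∈ Subset m ] (∣ Q ∣ ≤ ℓ × (∀ w → v ~ w → colour v w ∈ Q)))

      valid? : Dec Valid
      valid? = all? (λ x → all? λ y → all? λ z → x ≺? y →-dec y ≺? z →-dec x ≺? z)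
         ×-dec all? (λ x → all? λ y → tri? (x ≺? y) (x ≟ y) (y ≺? x))
         ×-dec all? (λ u → all? λ v → ~-dec u v →-dec colour u v ≟ colour v u)
         ×-dec all? (λ u → all? λ v → all? λ x → all? λ y →
                 ~-dec u v →-dec ~-dec x y →-dec colour u v ≟ colour x y →-dec
                 ¬? ((u ≺? x ×-dec x ≺? y ×-dec y ≺? v) ⊎-dec (x ≺? u ×-dec u ≺? v ×-dec v ≺? y)))
         ×-dec all? (λ v → anySubset? λ Q → ∣ Q ∣ ℕ.≤? ℓ ×-dec all? λ w →
                 ~-dec v w →-dec colour v w ∈? Q)
        where
        _≺?_ : ∀ u v → Dec (u ≺ v)
        u ≺? v = T? (before u v)

      decode : Valid → HasLocalLayout ℓ
      decode (≺-trans , ≺-cmp , colour-sym , nonnesting , local) =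
        record
          { _≺_                  = _≺_
          ; ≺-isStrictTotalOrder = isStrictTotalOrderᶜ record
              { isEquivalence = isEquivalence ; trans = ≺-trans _ _ _ ; compare = ≺-cmp }
          ; numQueues            = m
          ; queue                = λ {u} {v} _ → colour u v
          ; queue-sym            = λ e _ → colour-sym _ _ e
          ; queue-nonnesting     = λ e f → nonnesting _ _ _ _ e f
          } ,
        λ v → let Q , Q≤ℓ , v∈Q = local v in Q , Q≤ℓ , v∈Q _

    module Encode {ℓ : ℕ} (L : QueueLayout G) (local : QueueLayout.Local L ℓ) where
      open QueueLayout L
      module O = IsStrictTotalOrder ≺-isStrictTotalOrder

      queue-irrelevant : ∀ {u v} (e f : u ~ v) → queue e ≡ queue f
      queue-irrelevant e f = trans (queue-sym e (~-sym e)) (queue-sym (~-sym e) f)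

      Uses : Fin numQueues → Vertex → Vertex → Set
      Uses q u v = Σ[ e ∈ u ~ v ] queue e ≡ q

      uses? : ∀ q u v → Dec (Uses q u v)
      uses? q u v with ~-dec u v
      ... | no ¬e = no (¬e ∘ proj₁)
      ... | yes e = map′ (e ,_) (λ (f , eq) → trans (queue-irrelevant e f) eq) (queue e ≟ q)

      -- This bound depends on the graph alone, which makes the search for layouts finite.
      numColours : ℕ
      numColours = suc (order * order)

      -- Renames a queue after an edge in it; zero is junk for the empty queues.
      rename : Fin numQueues → Fin numColours
      rename q with any? (λ u → any? (uses? q u))
      ... | yes (u , v , _) = suc (combine u v)
      ... | no _            = zero

      -- Both queues are nonempty. If they have the same name, they both contain the edge that it
      -- encodes.
      rename-injective : ∀ {u v x y} (e : u ~ v) (f : x ~ y) →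
                         rename (queue e) ≡ rename (queue f) → queue e ≡ queue f
      rename-injective e f eq
        with any? (λ u → any? (uses? (queue e) u)) | any? (λ u → any? (uses? (queue f) u))
      ... | no ¬used | _ = ⊥-elim (¬used (_ , _ , e , refl))
      ... | yes _    | no ¬used = ⊥-elim (¬used (_ , _ , f , refl))
      ... | yes (u , v , e′ , eq₁) | yes (x , y , f′ , eq₂)
        with refl , refl ← combine-injective u v x y (Fin.suc-injective eq) =
        trans (sym eq₁) (trans (queue-irrelevant e′ f′) eq₂)

      colourOf : Vertex → Vertex → Fin numColours
      colourOf u v with ~-dec u v
      ... | yes e = rename (queue e)
      ... | no _  = zero

      colourOf-edge : ∀ {u v} (e : u ~ v) → colourOf u v ≡ rename (queue e)
      colourOf-edge {u} {v} e with ~-dec u v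
      ... | yes f = cong rename (queue-irrelevant f e)
      ... | no ¬e = ⊥-elim (¬e e)

      order-table : Table Bool order
      order-table = table λ u v → ⌊ u O.<? v ⌋

      colour-table : Table (Fin numColours) order
      colour-table = table colourOf

      ≺⁻ : ∀ {u v} → T (entry order-table u v) → u ≺ v
      ≺⁻ {u} {v} = toWitness ∘ subst T (entry∘table _ u v)

      ≺⁺ : ∀ {u v} → u ≺ v → T (entry order-table u v)
      ≺⁺ {u} {v} = subst T (sym (entry∘table _ u v)) ∘ fromWitness

      colour-edge : ∀ {u v} (e : u ~ v) → entry colour-table u v ≡ rename (queue e)
      colour-edge {u} {v} e = trans (entry∘table colourOf u v) (colourOf-edge e)

      valid : Code.Valid (entry order-table) (entry colour-table) ℓ
      valid = (λ _ _ _ x≺y y≺z → ≺⁺ (O.trans (≺⁻ x≺y) (≺⁻ y≺z)))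
            , cmp
            , (λ _ _ e → trans (colour-edge e)
                 (trans (cong rename (queue-sym e (~-sym e))) (sym (colour-edge (~-sym e)))))
            , (λ _ _ _ _ e f eq nest →
                 queue-nonnesting e f
                   (rename-injective e f (trans (sym (colour-edge e)) (trans eq (colour-edge f))))
                   (Sum.map ≺⁻³ ≺⁻³ nest))
            , λ v → let Q , Q≤ℓ , v∈Q = local v in
                image rename Q , ℕ.≤-trans (∣image∣≤ rename Q) Q≤ℓ ,
                λ w e → subst (_∈ image rename Q) (sym (colour-edge e)) (∈-image⁺ rename (v∈Q e))
        where
        ≺⁻³ : ∀ {a b c d e f} →
              T (entry order-table a b) × T (entry order-table c d) × T (entry order-table e f) →
              a ≺ b × c ≺ d × e ≺ f
        ≺⁻³ (p , q , r) = ≺⁻ p , ≺⁻ q , ≺⁻ r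
        cmp : ∀ x y → Tri (T (entry order-table x y)) (x ≡ y) (T (entry order-table y x))
        cmp x y with O.compare x y
        ... | tri< a ¬b ¬c = tri< (≺⁺ a) ¬b (¬c ∘ ≺⁻)
        ... | tri≈ ¬a b ¬c = tri≈ (¬a ∘ ≺⁻) b (¬c ∘ ≺⁻)
        ... | tri> ¬a ¬b c = tri> (¬a ∘ ≺⁻) ¬b (≺⁺ c)

  -- By `decode` and `Encode`, a layout exists exactly if some pair of tables is valid.
  hasLocalLayout? : Decidable HasLocalLayout
  hasLocalLayout? ℓ = map′
    (λ (t , c , valid) → Code.decode (entry t) (entry c) ℓ valid)
    (λ (L , local) → Encode.order-table L local , Encode.colour-table L local , Encode.valid L local)
    (searchVec (searchVec searchBool) λ t → searchVec (searchVec any?) λ c →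
      Code.valid? (entry t) (entry c) ℓ)

  private
    smaller : Vertex → Vertex → Vertex
    smaller u v with u <? v
    ... | yes _ = u
    ... | no _  = v

    smaller-< : ∀ {u v} → u Fin.< v → smaller u v ≡ u
    smaller-< {u} {v} u<v with u <? v
    ... | yes _  = refl
    ... | no u≮v = ⊥-elim (u≮v u<v)

    smaller-sym : ∀ {u v} → u ~ v → smaller u v ≡ smaller v u
    smaller-sym {u} {v} u~v with u <? v | v <? u
    ... | yes u<v | yes v<u = ⊥-elim (Fin.<-asym u<v v<u)
    ... | yes _   | no _    = refl
    ... | no _    | yes _   = refl
    ... | no u≮v  | no v≮u with Fin.<-cmp u v
    ...   | tri< u<v _ _ = ⊥-elim (u≮v u<v)
    ...   | tri≈ _ u≡v _ = ⊥-elim (~-irrefl u≡v u~v)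
    ...   | tri> _ _ v<u = ⊥-elim (v≮u v<u)

  -- Each edge goes to the queue of its smaller end. Edges with the same smaller end do not nest.
  starLayout : HasLocalLayout order
  starLayout =
    record
      { _≺_                  = Fin._<_
      ; ≺-isStrictTotalOrder = Fin.<-isStrictTotalOrder
      ; numQueues            = order
      ; queue                = λ {u} {v} _ → smaller u v
      ; queue-sym            = λ e _ → smaller-sym e
      ; queue-nonnesting     = λ where
          _ _ eq (inj₁ (u<x , x<y , y<v)) → Fin.<-irrefl
            (trans (sym (smaller-< (Fin.<-trans u<x (Fin.<-trans x<y y<v))))
              (trans eq (smaller-< x<y))) u<x
          _ _ eq (inj₂ (x<u , u<v , v<y)) → Fin.<-irrefl
            (trans (sym (smaller-< (Fin.<-trans x<u (Fin.<-trans u<v v<y))))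
              (trans (sym eq) (smaller-< u<v))) x<u
      } ,
    λ _ → ⊤ , ℕ.≤-reflexive (∣⊤∣≡n order) , λ _ → ∈⊤

  localQueueNumber : ∃ (IsLocalQueueNumber G)
  localQueueNumber = least hasLocalLayout? starLayout

-- Lower bound for local layouts

-- Expresses that at least `a` indices satisfy `P`.
Selection : ∀ {k} → ℕ → Pred (Fin k) 0ℓ → Set
Selection {k} a P = Σ[ h ∈ (Fin a → Fin k) ] Injective _≡_ _≡_ h × (∀ i → P (h i))

module _ {k} (P : Pred (Fin (suc k)) 0ℓ) where

  weaken : ∀ {a} → Selection a (P ∘ suc) → Selection a P
  weaken (h , h-inj , Ph) = suc ∘ h , h-inj ∘ Fin.suc-injective , Ph

  extend : ∀ {a} → P zero → Selection a (P ∘ suc) → Selection (suc a) P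
  extend {a} P0 (h , h-inj , Ph) = h′ , h′-inj , λ where
      zero    → P0
      (suc i) → Ph i
    where
    h′ : Fin (suc a) → Fin (suc k)
    h′ = zero Vector.∷ (suc ∘ h)
    h′-inj : Injective _≡_ _≡_ h′
    h′-inj {zero}  {zero}  _  = refl
    h′-inj {suc i} {suc j} eq = cong suc (h-inj (Fin.suc-injective eq))

select-none : ∀ {k} (P : Pred (Fin k) 0ℓ) → Selection 0 P
select-none _ = (λ ()) , (λ { {()} }) , λ ()

-- Fewer than `a` indices inside `P` and fewer than `b` outside would be at most `a + b - 2`
-- indices, which is less than `k`.
select : ∀ {k} {P : Pred (Fin k) 0ℓ} → Decidable P → ∀ a b → a + b ≤ suc k →
         Selection a P ⊎ Selection b (λ i → ¬ P i)
select {P = P} P? zero b _ = inj₁ (select-none P)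
select {P = P} P? (suc a) zero _ = inj₂ (select-none (¬_ ∘ P))
select {zero} P? (suc a) (suc b) (s≤s a+b≤0) with () ← subst (_≤ 0) (ℕ.+-suc a b) a+b≤0
select {suc k} {P} P? (suc a) (suc b) (s≤s a+b≤k) with P? zero
... | yes P0 = Sum.map (extend P P0) (weaken (¬_ ∘ P)) (select (P? ∘ suc) a (suc b) a+b≤k)
... | no ¬P0 = Sum.map (weaken P) (extend (¬_ ∘ P) ¬P0)
                 (select (P? ∘ suc) (suc a) b (subst (_≤ suc k) (ℕ.+-suc a b) a+b≤k))

private
  side : {A : Set} → Dec A → Fin 2
  side (yes _) = zero
  side (no _)  = suc zero

  side-≡ : {A B : Set} (A? : Dec A) (B? : Dec B) → side A? ≡ side B? → A → B
  side-≡ (yes _) (yes b) _ _ = b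
  side-≡ (no ¬a) _       _ a = ⊥-elim (¬a a)

module Layout {G : Graph} (L : QueueLayout G) {ℓ : ℕ} (local : QueueLayout.Local L ℓ) where
  open Graph G
  open QueueLayout L
  open IsStrictTotalOrder ≺-isStrictTotalOrder public
    using (compare) renaming (trans to ≺-trans; _<?_ to _≺?_)

  equal-colours : ∀ {v} (f : Fin (suc ℓ) → Vertex) (e : ∀ i → v ~ f i) →
                  ∃[ i ] ∃[ j ] i Fin.< j × queue (e i) ≡ queue (e j)
  equal-colours {v} f e with Q , Q≤ℓ , v∈Q ← local v
    with i , j , i<j , eq ← pigeonhole (s≤s Q≤ℓ) (rank ∘ v∈Q ∘ e)
    = i , j , i<j , rank-injective (v∈Q (e i)) (v∈Q (e j)) eq

  stars-nest : ∀ {a b x y} → a ≺ b → b ≺ x → x ≺ y →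
               (e : x ~ b) (f : y ~ a) → queue e ≢ queue f
  stars-nest a≺b b≺x x≺y e f eq = queue-nonnesting (~-sym f) (~-sym e)
    (trans (queue-sym (~-sym f) f) (trans (sym eq) (queue-sym e (~-sym e)))) (inj₁ (a≺b , b≺x , x≺y))

  -- A queue shared by `ea` and `eb` would contain all four edges. Of these, the edge from `y` to
  -- the left one of `a` and `b` nests with the edge from `x` to the other.
  twins-distinct-colours : ∀ {a b x y} → a ≢ b → a ≺ x → b ≺ x → x ≺ y →
    (ea : x ~ a) (eb : x ~ b) (fa : y ~ a) (fb : y ~ b) →
    queue ea ≡ queue fa → queue eb ≡ queue fb → queue ea ≢ queue eb
  twins-distinct-colours {a} {b} a≢b a≺x b≺x x≺y ea eb fa fb eqa eqb eq with compare a b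
  ... | tri< a≺b _ _ = stars-nest a≺b b≺x x≺y eb fa (trans (sym eq) eqa)
  ... | tri≈ _ a≡b _ = a≢b a≡b
  ... | tri> _ _ b≺a = stars-nest b≺a a≺x x≺y ea fb (trans eq eqb)

  -- Two of the `suc ℓ` edges at `x` share a queue, which `twins-distinct-colours` forbids.
  no-large-fan : ∀ {x y} {f : Fin (suc ℓ) → Vertex} → Injective _≡_ _≡_ f → (∀ i → f i ≺ x) → x ≺ y →
                 (e : ∀ i → x ~ f i) (e′ : ∀ i → y ~ f i) → ¬ (∀ i → queue (e i) ≡ queue (e′ i))
  no-large-fan f-inj f≺x x≺y e e′ same with i , j , i<j , eq ← equal-colours _ e =
    twins-distinct-colours (Fin.<⇒≢ i<j ∘ f-inj) (f≺x i) (f≺x j) x≺y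
      (e i) (e j) (e′ i) (e′ j) (same i) (same j) eq

  -- The ℓ edges from v₁ to the left vertices f i use up all colours at v₁, and
  -- another edge to the left would nest with one of these stars.
  only-fan-left : ∀ {v₀ v₁ v₂ w} {f : Fin ℓ → Vertex} → Injective _≡_ _≡_ f →
    (∀ i → f i ≺ v₀) → v₀ ≺ v₁ → v₁ ≺ v₂ →
    (e₀ : ∀ i → v₀ ~ f i) (e₁ : ∀ i → v₁ ~ f i) (e₂ : ∀ i → v₂ ~ f i) →
    (∀ i → queue (e₀ i) ≡ queue (e₁ i)) → (∀ i → queue (e₁ i) ≡ queue (e₂ i)) →
    v₁ ~ w → (∀ i → w ≢ f i) → v₁ ≺ w
  only-fan-left {v₁ = v₁} {w = w} {f} f-inj f≺v₀ v₀≺v₁ v₁≺v₂ e₀ e₁ e₂ same₀ same₁ v₁~w w≢f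
    with compare v₁ w
  ... | tri< v₁≺w _ _ = v₁≺w
  ... | tri≈ _ v₁≡w _ = ⊥-elim (~-irrefl v₁≡w v₁~w)
  ... | tri> _ _ w≺v₁ with equal-colours (w Vector.∷ f) (λ where zero → v₁~w
                                                                 (suc i) → e₁ i)
  ...   | zero , suc j , _ , eq with compare w (f j)
  ...     | tri< w≺fj _ _ = ⊥-elim
            (stars-nest w≺fj (f≺v₀ j) v₀≺v₁ (e₀ j) v₁~w (trans (same₀ j) (sym eq)))
  ...     | tri≈ _ w≡fj _ = ⊥-elim (w≢f j w≡fj)
  ...     | tri> _ _ fj≺w = ⊥-elim (stars-nest fj≺w w≺v₁ v₁≺v₂ v₁~w (e₂ j) (trans eq (same₁ j)))
  only-fan-left f-inj f≺v₀ v₀≺v₁ v₁≺v₂ e₀ e₁ e₂ same₀ same₁ v₁~w w≢f | tri> _ _ w≺v₁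
    | suc i , suc j , s≤s i<j , eq =
    ⊥-elim (twins-distinct-colours (Fin.<⇒≢ i<j ∘ f-inj)
      (≺-trans (f≺v₀ i) v₀≺v₁) (≺-trans (f≺v₀ j) v₀≺v₁) v₁≺v₂
      (e₁ i) (e₁ j) (e₂ i) (e₂ j) (same₁ i) (same₁ j) eq)

  module _ {k : ℕ} {base : Fin k → Vertex} where

    -- Each base vertex records the side on which x lies and which of its at most ℓ
    -- queues contains the edge to x.
    kind : ∀ {x} → (∀ i → x ~ base i) → Fin ((2 * ℓ) ^ k)
    kind {x} e = funToFin λ i → combine (side (base i ≺? x)) (colour i)
      where
      colour : Fin k → Fin ℓ
      colour i = let _ , Q≤ℓ , b∈Q = local (base i) in inject≤ (rank (b∈Q (~-sym (e i)))) Q≤ℓ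

    module _ {x y} (e : ∀ i → x ~ base i) (f : ∀ i → y ~ base i)
             (eq : kind e ≡ kind f) (i : Fin k) where

      private
        parts = combine-injective (side (base i ≺? x)) _ (side (base i ≺? y)) _
          (trans (sym (finToFun-funToFin _ i))
            (trans (cong (λ κ → finToFun {2 * ℓ} κ i) eq) (finToFun-funToFin _ i)))

      kind-≺ : base i ≺ x → base i ≺ y
      kind-≺ = side-≡ (base i ≺? x) (base i ≺? y) (proj₁ parts)

      -- The ranks are comparable because both refer to the queues at `base i`, a common neighbour
      -- of `x` and `y`.
      kind-colour : queue (e i) ≡ queue (f i)
      kind-colour = let _ , Q≤ℓ , b∈Q = local (base i) in
        trans (queue-sym (e i) (~-sym (e i)))
          (trans (rank-injective (b∈Q (~-sym (e i))) (b∈Q (~-sym (f i)))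
                   (inject≤-injective Q≤ℓ Q≤ℓ _ _ (proj₂ parts)))
            (queue-sym (~-sym (f i)) (f i)))

-- Nesting survives reversal once both edges are named from their other ends. This reduces the case
-- of many roots on the right to that of many roots on the left.
reverseLayout : {G : Graph} → QueueLayout G → QueueLayout G
reverseLayout {G} L = record
  { _≺_                  = flip _≺_
  ; ≺-isStrictTotalOrder = Flip.isStrictTotalOrder ≺-isStrictTotalOrder
  ; numQueues            = numQueues
  ; queue                = queue
  ; queue-sym            = queue-sym
  ; queue-nonnesting     = λ where
      e f eq (inj₁ (x≺u , y≺x , v≺y)) →
        queue-nonnesting (~-sym e) (~-sym f) (eq′ e f eq) (inj₁ (v≺y , y≺x , x≺u))
      e f eq (inj₂ (u≺x , v≺u , y≺v)) →
        queue-nonnesting (~-sym e) (~-sym f) (eq′ e f eq) (inj₂ (y≺v , v≺u , u≺x))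
  }
  where
  open Graph G
  open QueueLayout L
  eq′ : ∀ {u v x y} (e : u ~ v) (f : x ~ y) → queue e ≡ queue f → queue (~-sym e) ≡ queue (~-sym f)
  eq′ e f eq = trans (queue-sym (~-sym e) e) (trans eq (queue-sym f (~-sym f)))

-- The adjacencies needed for the lower bound. The family `base v b` consists of the roots with
-- `root b` replaced by `mid v`; keeping it indexed by `Fin k` lets `kind` apply to leaves as well
-- as to mids.
record Gadget (G : Graph) (k N M : ℕ) : Set where
  open Graph G
  field
    root : Fin k → Vertex
    mid  : Fin N → Vertex
    leaf : Fin N → Fin k → Fin M → Vertex
    base : Fin N → Fin k → Fin k → Vertex

    root-injective : Injective _≡_ _≡_ root
    mid-injective  : Injective _≡_ _≡_ mid
    leaf-injective : ∀ {v b} → Injective _≡_ _≡_ (leaf v b)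
    mid≢root       : ∀ {v i} → mid v ≢ root i
    leaf≢root      : ∀ {v b m i} → leaf v b m ≢ root i

    base-omitted : ∀ {v b} → base v b b ≡ mid v
    base-root    : ∀ {v b i} → i ≢ b → base v b i ≡ root i

    mid~root  : ∀ v i → mid v ~ root i
    leaf~base : ∀ v b m i → leaf v b m ~ base v b i

  base-injective : ∀ {v b} → Injective _≡_ _≡_ (base v b)
  base-injective {v} {b} {i} {j} eq with i ≟ b | j ≟ b
  ... | yes refl | yes refl = refl
  ... | yes refl | no j≢b   = ⊥-elim (mid≢root (trans (sym base-omitted) (trans eq (base-root j≢b))))
  ... | no i≢b   | yes refl = ⊥-elim
    (mid≢root (sym (trans (sym (base-root i≢b)) (trans eq base-omitted))))
  ... | no i≢b   | no j≢b   = root-injective (trans (sym (base-root i≢b)) (trans eq (base-root j≢b)))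

module _ {G : Graph} {k ℓ N M : ℕ} (ℓ<k : ℓ < k) (kinds<M : (2 * ℓ) ^ k < M)
         (gadget : Gadget G k N M) where
  open Graph G
  open Gadget gadget

  -- The hypotheses compare queues instead of kinds, since reversal preserves queues but not kinds.
  no-left-selection : (L : QueueLayout G) → QueueLayout.Local L ℓ → let open QueueLayout L in
    ∀ {v₀ v₁ v₂} → mid v₀ ≺ mid v₁ → mid v₁ ≺ mid v₂ →
    (∀ i → queue (mid~root v₀ i) ≡ queue (mid~root v₁ i)) →
    (∀ i → queue (mid~root v₁ i) ≡ queue (mid~root v₂ i)) →
    ¬ Selection ℓ (λ i → root i ≺ mid v₀)
  no-left-selection L local {v₀} {v₁} {v₂} v₀≺v₁ v₁≺v₂ same₀ same₁ (h , h-inj , h≺v₀) =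
    leaves-collide (pigeonhole kinds<M (λ m → kind (leaf~base v₁ b m)))
    where
    open QueueLayout L
    open Layout L local

    -- Any `suc ℓ` roots would form a large fan at `mid v₀` and `mid v₁`; here `ℓ < k` is used.
    not-all-left : ¬ (∀ i → root i ≺ mid v₀)
    not-all-left root≺ = no-large-fan
      (λ eq → inject≤-injective ℓ<k ℓ<k _ _ (root-injective eq)) (root≺ ∘ ι) v₀≺v₁
      (mid~root v₀ ∘ ι) (mid~root v₁ ∘ ι) (same₀ ∘ ι)
      where
      ι : Fin (suc ℓ) → Fin k
      ι i = inject≤ i ℓ<k

    omitted : ∃[ b ] ¬ root b ≺ mid v₀
    omitted = ¬∀⟶∃¬ k _ (λ i → root i ≺? mid v₀) not-all-left

    b : Fin k
    b = proj₁ omitted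

    -- Hence the selected roots are all adjacent to the leaves that omit `b`.
    h≢b : ∀ i → h i ≢ b
    h≢b i hi≡b = proj₂ omitted (subst (λ j → root j ≺ mid v₀) hi≡b (h≺v₀ i))

    mid≺leaf : ∀ m → mid v₁ ≺ leaf v₁ b m
    mid≺leaf m = only-fan-left (h-inj ∘ root-injective) h≺v₀ v₀≺v₁ v₁≺v₂
      (mid~root v₀ ∘ h) (mid~root v₁ ∘ h) (mid~root v₂ ∘ h) (same₀ ∘ h) (same₁ ∘ h)
      (~-sym (subst (leaf v₁ b m ~_) base-omitted (leaf~base v₁ b m b))) (λ _ → leaf≢root)

    -- At position `b` the base is `mid v₁`. With the `ℓ` selected roots this gives `suc ℓ` common
    -- neighbours to the left of the leaves.
    g : Fin (suc ℓ) → Fin k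
    g = b Vector.∷ h

    g-injective : Injective _≡_ _≡_ g
    g-injective {zero}  {zero}  _  = refl
    g-injective {zero}  {suc j} eq = ⊥-elim (h≢b j (sym eq))
    g-injective {suc i} {zero}  eq = ⊥-elim (h≢b i eq)
    g-injective {suc i} {suc j} eq = cong suc (h-inj eq)

    base≺leaf : ∀ m i → base v₁ b (g i) ≺ leaf v₁ b m
    base≺leaf m zero    = subst (_≺ leaf v₁ b m) (sym base-omitted) (mid≺leaf m)
    base≺leaf m (suc i) = subst (_≺ leaf v₁ b m) (sym (base-root (h≢b i)))
      (≺-trans (h≺v₀ i) (≺-trans v₀≺v₁ (mid≺leaf m)))

    collide : ∀ {m m′} → leaf v₁ b m ≺ leaf v₁ b m′ →
              kind (leaf~base v₁ b m) ≢ kind (leaf~base v₁ b m′)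
    collide {m} {m′} x≺y eq = no-large-fan (g-injective ∘ base-injective) (base≺leaf m) x≺y
      (leaf~base v₁ b m ∘ g) (leaf~base v₁ b m′ ∘ g)
      (kind-colour (leaf~base v₁ b m) (leaf~base v₁ b m′) eq ∘ g)

    leaves-collide : ¬ (∃[ m ] ∃[ m′ ] m Fin.< m′ ×
                        kind (leaf~base v₁ b m) ≡ kind (leaf~base v₁ b m′))
    leaves-collide (m , m′ , m<m′ , eq) with compare (leaf v₁ b m) (leaf v₁ b m′)
    ... | tri< x≺y _ _ = collide x≺y eq
    ... | tri≈ _ x≡y _ = Fin.<⇒≢ m<m′ (leaf-injective x≡y)
    ... | tri> _ _ y≺x = collide y≺x (sym eq)

module _ {G : Graph} {k ℓ M : ℕ} (ℓ<k : ℓ < k) (2ℓ≤1+k : ℓ + ℓ ≤ suc k) (kinds<M : (2 * ℓ) ^ k < M)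
         (gadget : Gadget G k (M * M) M) where
  open Graph G
  open Gadget gadget

  -- The mids form `M` blocks of size `M`. Each block has two mids of equal kind, and two blocks
  -- agree in this kind, so three mids have the same kind.
  gadget-not-local : (L : QueueLayout G) → ¬ QueueLayout.Local L ℓ
  gadget-not-local L local =
    blocks-collide (pigeonhole kinds<M λ p → midKind (combine p (proj₁ (block p))))
    where
    open QueueLayout L
    open Layout L local

    midKind : Fin (M * M) → Fin ((2 * ℓ) ^ k)
    midKind v = kind (mid~root v)

    no-sorted-triple : ∀ {v₀ v₁ v₂} → mid v₀ ≺ mid v₁ → mid v₁ ≺ mid v₂ →
                       midKind v₀ ≡ midKind v₁ → midKind v₁ ≢ midKind v₂
    no-sorted-triple {v₀} {v₁} {v₂} v₀≺v₁ v₁≺v₂ eq₀ eq₁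
      -- As `ℓ + ℓ ≤ suc k`, there are `ℓ` roots to the left of `mid v₁` or `ℓ` roots not to its
      -- left. Equal kinds carry this over to `mid v₀` or `mid v₂`.
      with select (λ i → root i ≺? mid v₁) ℓ ℓ 2ℓ≤1+k
    ... | inj₁ (h , h-inj , h≺) = no-left-selection ℓ<k kinds<M gadget L local v₀≺v₁ v₁≺v₂
      (kind-colour _ _ eq₀) (kind-colour _ _ eq₁)
      (h , h-inj , λ i → kind-≺ (mid~root v₁) (mid~root v₀) (sym eq₀) (h i) (h≺ i))
    -- In the reversed layout `v₀` and `v₂` swap roles.
    ... | inj₂ (h , h-inj , h⊀) = no-left-selection ℓ<k kinds<M gadget
      (reverseLayout L) local v₁≺v₂ v₀≺v₁
      (λ i → sym (kind-colour (mid~root v₁) (mid~root v₂) eq₁ i))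
      (λ i → sym (kind-colour (mid~root v₀) (mid~root v₁) eq₀ i))
      (h , h-inj , right)
      where
      right : ∀ i → mid v₂ ≺ root (h i)
      right i with compare (mid v₂) (root (h i))
      ... | tri< v≺r _ _ = v≺r
      ... | tri≈ _ v≡r _ = ⊥-elim (mid≢root v≡r)
      ... | tri> _ _ r≺v = ⊥-elim (h⊀ i (kind-≺ (mid~root v₂) (mid~root v₁) (sym eq₁) (h i) r≺v))

    insert : ∀ {u v w} → mid u ≺ mid v → w ≢ u → w ≢ v →
             midKind u ≡ midKind v → midKind u ≢ midKind w
    insert {u} {v} {w} u≺v w≢u w≢v uv uw with compare (mid w) (mid u) | compare (mid w) (mid v)
    ... | tri< w≺u _ _ | _            = no-sorted-triple w≺u u≺v (sym uw) uv
    ... | tri≈ _ w≡u _ | _            = w≢u (mid-injective w≡u)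
    ... | tri> _ _ u≺w | tri< w≺v _ _ = no-sorted-triple u≺w w≺v uw (trans (sym uw) uv)
    ... | tri> _ _ u≺w | tri≈ _ w≡v _ = w≢v (mid-injective w≡v)
    ... | tri> _ _ u≺w | tri> _ _ v≺w = no-sorted-triple u≺v v≺w uv (trans (sym uv) uw)

    no-triple : ∀ {u v w} → u ≢ v → w ≢ u → w ≢ v →
                midKind u ≡ midKind v → midKind u ≢ midKind w
    no-triple {u} {v} u≢v w≢u w≢v uv uw with compare (mid u) (mid v)
    ... | tri< u≺v _ _ = insert u≺v w≢u w≢v uv uw
    ... | tri≈ _ u≡v _ = u≢v (mid-injective u≡v)
    ... | tri> _ _ v≺u = insert v≺u w≢v w≢u (sym uv) (trans (sym uv) uw)

    block : ∀ p → ∃[ q ] ∃[ q′ ] q Fin.< q′ × midKind (combine p q) ≡ midKind (combine p q′)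
    block p = pigeonhole kinds<M (midKind ∘ combine p)

    blocks-collide : ¬ (∃[ p ] ∃[ p′ ] p Fin.< p′ ×
      midKind (combine p (proj₁ (block p))) ≡ midKind (combine p′ (proj₁ (block p′))))
    blocks-collide (p , p′ , p<p′ , eq) =
      let q , q′ , q<q′ , eq′ = block p in
      no-triple (Fin.<⇒≢ q<q′ ∘ proj₂ ∘ combine-injective p q p q′)
        (Fin.<⇒≢ p<p′ ∘ sym ∘ proj₁ ∘ combine-injective p′ _ p q)
        (Fin.<⇒≢ p<p′ ∘ sym ∘ proj₁ ∘ combine-injective p′ _ p q′)
        eq′ eq

-- The graph

module _ (k₀ N M : ℕ) where

  private
    k = suc k₀

    V : Set
    V = Fin k ⊎ (Fin N ⊎ (Fin N × (Fin k × Fin M)))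

    pattern rootᵛ i     = inj₁ i
    pattern midᵛ v      = inj₂ (inj₁ v)
    pattern leafᵛ v b m = inj₂ (inj₂ (v , (b , m)))

    size : ℕ
    size = k + (N + N * (k * M))

    abstract
      V↔Fin : Fin size ↔ V
      V↔Fin = (↔-id _ ⊎-↔ ((↔-id _ ⊎-↔ ((↔-id _ ×-↔ *↔×) ↔-∘ *↔×)) ↔-∘ +↔⊎)) ↔-∘ +↔⊎

    open Inverse V↔Fin using ()
      renaming (to to decodeᵛ; from to code; strictlyInverseˡ to decodeᵛ∘code)

    code-injective : ∀ {x y} → code x ≡ code y → x ≡ y
    code-injective {x} {y} eq =
      trans (sym (decodeᵛ∘code x)) (trans (cong decodeᵛ eq) (decodeᵛ∘code y))

    leafBase : Fin N → Fin k → Fin k → V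
    leafBase v b i with i ≟ b
    ... | yes _ = midᵛ v
    ... | no _  = rootᵛ i

    leafBase-omitted : ∀ v b → leafBase v b b ≡ midᵛ v
    leafBase-omitted v b with b ≟ b
    ... | yes _  = refl
    ... | no b≢b = ⊥-elim (b≢b refl)

    leafBase-root : ∀ v {b i} → i ≢ b → leafBase v b i ≡ rootᵛ i
    leafBase-root v {b} {i} i≢b with i ≟ b
    ... | yes i≡b = ⊥-elim (i≢b i≡b)
    ... | no _    = refl

    baseᵛ : V → Fin k → V
    baseᵛ (rootᵛ _)     = rootᵛ
    baseᵛ (midᵛ _)      = rootᵛ
    baseᵛ (leafᵛ v b _) = leafBase v b

    -- The decomposition tree has root zero on top, the other roots and the mids below it, and each
    -- leaf below its mid. All roots have the same bag, so any of them could be the top.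
    parentᵛ : V → V
    parentᵛ (rootᵛ _)     = rootᵛ zero
    parentᵛ (midᵛ _)      = rootᵛ zero
    parentᵛ (leafᵛ v _ _) = midᵛ v

    baseᶠ : Fin size → Fin k → Fin size
    baseᶠ t i = code (baseᵛ (decodeᵛ t) i)

    parentᶠ : Fin size → Fin size
    parentᶠ = code ∘ parentᵛ ∘ decodeᵛ

    topᶠ : Fin size
    topᶠ = code (rootᵛ zero)

    baseᶠ-code : ∀ x i → baseᶠ (code x) i ≡ code (baseᵛ x i)
    baseᶠ-code x i = cong (λ y → code (baseᵛ y i)) (decodeᵛ∘code x)

    parentᶠ-code : ∀ x → parentᶠ (code x) ≡ code (parentᵛ x)
    parentᶠ-code x = cong (code ∘ parentᵛ) (decodeᵛ∘code x)

    height-twoᵛ : ∀ x → parentᵛ (parentᵛ x) ≡ rootᵛ zero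
    height-twoᵛ (rootᵛ _)     = refl
    height-twoᵛ (midᵛ _)      = refl
    height-twoᵛ (leafᵛ _ _ _) = refl

    height-two : ∀ t → parentᶠ (parentᶠ t) ≡ topᶠ
    height-two t = trans (parentᶠ-code (parentᵛ (decodeᵛ t))) (cong code (height-twoᵛ (decodeᵛ t)))

    inheritᵛ : ∀ x i → baseᵛ x i ≡ parentᵛ x ⊎ ∃[ j ] baseᵛ x i ≡ baseᵛ (parentᵛ x) j
    inheritᵛ (rootᵛ _) i = inj₂ (i , refl)
    inheritᵛ (midᵛ _)  i = inj₂ (i , refl)
    inheritᵛ (leafᵛ v b _) i with i ≟ b
    ... | yes _ = inj₁ refl
    ... | no _  = inj₂ (i , refl)

    inherit : ∀ {u t} → ∃[ i ] u ≡ baseᶠ t i → InBag baseᶠ u (parentᶠ t)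
    inherit {t = t} (i , refl) = Sum.map (cong code)
      (λ (j , eq) → j , trans (cong code eq) (sym (baseᶠ-code (parentᵛ (decodeᵛ t)) j)))
      (inheritᵛ (decodeᵛ t) i)

    attach-top : ∀ {u} → InBag baseᶠ u topᶠ → parentᶠ u ≡ topᶠ
    attach-top (inj₁ refl)       = parentᶠ-code (rootᵛ zero)
    attach-top (inj₂ (i , refl)) =
      trans (cong parentᶠ (baseᶠ-code (rootᵛ zero) i)) (parentᶠ-code (rootᵛ i))

  gadgetGraph : Graph
  gadgetGraph = attach baseᶠ

  private
    open Graph gadgetGraph

    edge : ∀ {x} i → baseᵛ x i ≢ x → code x ~ code (baseᵛ x i)
    edge {x} i b≢x = b≢x ∘ sym ∘ code-injective , inj₂ (i , sym (baseᶠ-code x i))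

    leafBase≢leaf : ∀ {v b m} i → leafBase v b i ≢ leafᵛ v b m
    leafBase≢leaf {b = b} i eq with i ≟ b
    leafBase≢leaf i () | yes _
    leafBase≢leaf i () | no _

  gadget : Gadget gadgetGraph k N M
  gadget = record
    { root           = code ∘ rootᵛ
    ; mid            = λ v → code (midᵛ v)
    ; leaf           = λ v b m → code (leafᵛ v b m)
    ; base           = λ v b i → code (leafBase v b i)
    ; root-injective = inj₁-injective ∘ code-injective
    ; mid-injective  = inj₁-injective ∘ inj₂-injective ∘ code-injective
    ; leaf-injective = leafᵛ-injective ∘ code-injective
    ; mid≢root       = λ eq → midᵛ≢rootᵛ (code-injective eq)
    ; leaf≢root      = λ eq → leafᵛ≢rootᵛ (code-injective eq)
    ; base-omitted   = cong code (leafBase-omitted _ _)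
    ; base-root      = cong code ∘ leafBase-root _
    ; mid~root       = λ v i → edge {midᵛ v} i λ ()
    ; leaf~base      = λ v b m i → edge {leafᵛ v b m} i (leafBase≢leaf i)
    }
    where
    leafᵛ-injective : ∀ {v b m m′} → _≡_ {A = V} (leafᵛ v b m) (leafᵛ v b m′) → m ≡ m′
    leafᵛ-injective refl = refl
    midᵛ≢rootᵛ : ∀ {v i} → _≢_ {A = V} (midᵛ v) (rootᵛ i)
    midᵛ≢rootᵛ ()
    leafᵛ≢rootᵛ : ∀ {v b m i} → _≢_ {A = V} (leafᵛ v b m) (rootᵛ i)
    leafᵛ≢rootᵛ ()

  -- The upper bound comes from the decomposition, the lower bound from the clique of all roots and
  -- one mid `v`.
  gadgetGraph-treewidth : Fin N → IsTreewidth gadgetGraph k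
  gadgetGraph-treewidth v =
    (D , ℕ.≤-antisym (width≤ baseᶠ parentᶠ topᶠ height-two inherit attach-top) (≤width D)) ,
    λ where _ (D′ , refl) → ≤width D′
    where
    D : TreeDecomposition gadgetGraph
    D = decomposition baseᶠ parentᶠ topᶠ height-two inherit attach-top

    clique : Fin (suc k) → Vertex
    clique zero    = code (midᵛ v)
    clique (suc i) = code (rootᵛ i)

    clique-adjacent : ∀ {i j} → i ≢ j → clique i ~ clique j
    clique-adjacent {zero}  {zero}  i≢j = ⊥-elim (i≢j refl)
    clique-adjacent {zero}  {suc j} _   = edge {midᵛ v} j λ ()
    clique-adjacent {suc i} {zero}  _   = ~-sym {code (midᵛ v)} {code (rootᵛ i)}
      (edge {midᵛ v} i λ ())
    clique-adjacent {suc i} {suc j} i≢j = edge {rootᵛ i} j λ where refl → i≢j refl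

    ≤width : (D : TreeDecomposition gadgetGraph) → k ≤ TreeDecomposition.width D
    ≤width D = clique⇒≤width D clique clique-adjacent

-- Combining the bounds

⌈n/2⌉+⌈n/2⌉≤1+n : ∀ n → ⌈ n /2⌉ + ⌈ n /2⌉ ≤ suc n
⌈n/2⌉+⌈n/2⌉≤1+n n = ℕ.≤-trans (ℕ.+-monoʳ-≤ ⌈ n /2⌉ (ℕ.⌊n/2⌋≤⌈n/2⌉ (suc n)))
  (ℕ.≤-reflexive (ℕ.⌊n/2⌋+⌈n/2⌉≡n (suc n)))

local-mono : {G : Graph} (L : QueueLayout G) {ℓ ℓ′ : ℕ} → ℓ ≤ ℓ′ →
             QueueLayout.Local L ℓ → QueueLayout.Local L ℓ′
local-mono L ℓ≤ℓ′ local v = let Q , Q≤ℓ , v∈Q = local v in Q , ℕ.≤-trans Q≤ℓ ℓ≤ℓ′ , v∈Q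

localQueueNumber> : (G : Graph) {ℓ : ℕ} → (∀ (L : QueueLayout G) → ¬ QueueLayout.Local L ℓ) →
                    Σ[ ℓ′ ∈ ℕ ] (IsLocalQueueNumber G ℓ′ × ℓ + 1 ≤ ℓ′)
localQueueNumber> G {ℓ} not-local
  with ℓ′ , least@((L , local) , _) ← localQueueNumber G = ℓ′ , least ,
  ℕ.≤-trans (ℕ.≤-reflexive (ℕ.+-comm ℓ 1)) (ℕ.≰⇒> λ ℓ′≤ℓ → not-local L (local-mono L ℓ′≤ℓ local))

theorem5 : (k : ℕ) → 1 < k →
    Σ[ G ∈ Graph ] (IsTreewidth G k × (Σ[ ℓ ∈ ℕ ] (IsLocalQueueNumber G ℓ × ⌈ k /2⌉ + 1 ≤ ℓ)))
theorem5 k@(suc (suc k-2)) (s≤s (s≤s z≤n)) =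
  gadgetGraph (suc k-2) (M * M) M , gadgetGraph-treewidth (suc k-2) (M * M) M zero ,
  -- The assumption `1 < k` gives `⌈ k /2⌉ < k`.
  localQueueNumber> _ (gadget-not-local (ℕ.⌈n/2⌉<n k-2) (⌈n/2⌉+⌈n/2⌉≤1+n k) ℕ.≤-refl
    (gadget (suc k-2) (M * M) M))
  where
  M : ℕ
  -- One more than the number of kinds for `ℓ = ⌈ k /2⌉`.
  M = suc ((2 * ⌈ k /2⌉) ^ k)
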